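{- Let $K=\{123,132\}\{213,312\}$ and let $f(n)$ be the number of equivalence classes of $S_n$ under $K$-equivalence. Then for all integers $n\ge 3$, $$f(n)=f(n-1)+(n-1)\cdot f(n-2).$$
   Context: Permutations in $S_n$ are written as words $\pi_1\pi_2\cdots\pi_n$ in one-line notation. The order permutation of a word $u$ of $c$ distinct positive integers is the unique $\sigma\in S_c$ with $\sigma_i<\sigma_j$ iff $u_i<u_j$. A replacement partition $K$ of $S_c$ is a set partition of $S_c$; it is denoted by listing its parts with the one-element parts (and outer brackets) omitted, so here $K$ is the set partition of $S_3$ whose only parts of size greater than one are $\{123,132\}$ and $\{213,312\}$. The $K$-equivalence on $S_n$ is the equivalence relation generated by: $\phi\equiv\psi$ whenever $\phi=aub$ and $\psi=avb$ (concatenations) for some possibly empty words $a,b$ and words $u,v$ of length $c$ (so $u,v$ occupy the same $c$ consecutive positions) such that the order permutations of $u$ and $v$ lie in the same part of $K$. All equivalence classes are counted, including one-element classes (so when $n<3$ every class is a singleton). -}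

module Defs where

open import Data.Empty using (⊥)
open import Data.Fin.Base using (Fin; zero; suc)
import Data.Fin.Properties as Fin
open import Data.Irrelevant using ([_])
open import Data.List.Base as List using (List; []; _∷_; _++_)
open import Data.List.Membership.Propositional using (_∈_; find; lose)
open import Data.List.Membership.Propositional.Properties
  using (∈-cartesianProduct⁺; ∈-cartesianProductWith⁺; ∈-++⁺ˡ; ∈-++⁺ʳ;
         ∈-map⁺; ∈-upTo⁺)
import Data.List.Properties as List
open import Data.List.Relation.Unary.Any as Any using (Any; here; there)
open import Data.Nat.Base as ℕ using (ℕ; zero; suc; _≤_; _<_; s≤s; z≤n)
import Data.Nat.Properties as ℕ
open import Data.Product.Base using (∃; ∃₂; _×_; _,_; proj₁; proj₂)
open import Data.Refinement.Base using (Refinement; Refinement-syntax; value; _,_)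
import Data.Refinement.Properties as Refinement
open import Data.Sum.Base using (_⊎_; inj₁; inj₂)
open import Data.Vec.Base as Vec using (Vec; []; _∷_; lookup; toList)
import Data.Vec.Properties as Vec
open import Data.Vec.Relation.Unary.All as All using (All; []; _∷_)
open import Data.Vec.Relation.Unary.AllPairs using (allPairs?)
open import Data.Vec.Relation.Unary.Unique.Propositional using (Unique)
open import Function.Base using (_∘_)
open import Function.Bundles using (Bijection; _⇔_; mk⇔; Equivalence)
open import Function.Definitions using (Injective)
open import Level using (0ℓ)
open import Relation.Binary.Bundles using (Setoid)
open import Relation.Binary.Construct.Closure.Equivalence as Closure using (EqClosure)
import Relation.Binary.Construct.On as On
open import Relation.Binary.Core using (Rel)
open import Relation.Binary.Definitions using (Decidable; DecidableEquality)
open import Relation.Binary.PropositionalEquality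
  using (_≡_; _≢_; refl; sym; trans; cong; cong₂; subst)
import Relation.Binary.PropositionalEquality.Properties as ≡
open import Relation.Nullary.Decidable
  using (Dec; yes; no; True; toWitness; recompute; map′; ¬?; _×-dec_; _⊎-dec_; _→-dec_)
open import Relation.Nullary.Negation using (contradiction)

IsPermutation : ∀ {n} → Vec ℕ n → Set
IsPermutation {n} w = All (λ x → 1 ≤ x × x ≤ n) w × Unique w

-- The proof component is irrelevant, so permutations are equal as soon as
-- their words are.

Perm : ℕ → Set
Perm n = [ w ∈ Vec ℕ n ∣ IsPermutation w ]

isPermutation? : ∀ {n} (w : Vec ℕ n) → Dec (IsPermutation w)
isPermutation? {n} w =
  All.all? (λ x → 1 ℕ.≤? x ×-dec x ℕ.≤? n) w
    ×-dec allPairs? (λ x y → ¬? (x ℕ.≟ y)) w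

perm : ∀ {n} (w : Vec ℕ n) {ok : True (isPermutation? w)} → Perm n
perm w {ok} = w , [ toWitness ok ]

_IsOrderPermOf_ : ∀ {c} → Perm c → Vec ℕ c → Set
σ IsOrderPermOf u =
  ∀ i j → (lookup (value σ) i < lookup (value σ) j) ⇔ (lookup u i < lookup u j)

-- A set partition of S_c, given by a list of (disjoint) parts that includes
-- all those with more than one element; unlisted permutations are singletons.

Parts : ℕ → Set
Parts c = List (List (Perm c))

SamePart : ∀ {c} → Parts c → Rel (Perm c) 0ℓ
SamePart K σ τ = σ ≡ τ ⊎ Any (λ part → σ ∈ part × τ ∈ part) K

Replaceable : ∀ {c} → Parts c → Rel (Vec ℕ c) 0ℓ
Replaceable K u v =
  ∃₂ λ σ τ → σ IsOrderPermOf u × τ IsOrderPermOf v × SamePart K σ τ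

ReplaceIn : ∀ {c} → Parts c → Rel (List ℕ) 0ℓ
ReplaceIn {c} K φ ψ =
  ∃₂ λ (a b : List ℕ) → ∃₂ λ (u v : Vec ℕ c) →
    φ ≡ a ++ toList u ++ b × ψ ≡ a ++ toList v ++ b × Replaceable K u v

Replace : ∀ {c} → Parts c → ∀ n → Rel (Perm n) 0ℓ
Replace K n φ ψ = ReplaceIn K (toList (value φ)) (toList (value ψ))

K-equivalence : ∀ {c} → Parts c → ℕ → Setoid 0ℓ 0ℓ
K-equivalence K n = Closure.setoid (Replace K n)

-- Since bijections of setoids respect and reflect the equivalences, this is
-- a bijection from the set of equivalence classes of S to a set of size m.

HasClasses : Setoid 0ℓ 0ℓ → ℕ → Set
HasClasses S m = Bijection S (≡.setoid (Fin m))

hasClasses-unique : ∀ S {m n} → HasClasses S m → HasClasses S n → m ≡ n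
hasClasses-unique S B C = ℕ.≤-antisym (below B C) (below C B)
  where
  open Bijection using (to; injective; surjective)
  below : ∀ {m n} → HasClasses S m → HasClasses S n → m ≤ n
  below B C = Fin.injective⇒≤ {f = to C ∘ from} λ {i} {j} eq →
    trans (sym (to-from i))
      (trans (Bijection.cong B (injective C eq)) (to-from j))
    where
    from : Fin _ → Setoid.Carrier S
    from i = proj₁ (surjective B i)
    to-from : ∀ i → to B (from i) ≡ i
    to-from i = proj₂ (surjective B i) (Setoid.refl S)

-- Shows that the count used in numClasses exists: the equivalence generated by a
-- decidable relation on a finite set is decided by merging representatives
-- along each related pair in turn.

module _ {A : Set} (_≟_ : DecidableEquality A)
         (elements : List A) (complete : ∀ x → x ∈ elements)
         {R : Rel A 0ℓ} (R? : Decidable R) where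

  private
    open module Cl = Setoid (Closure.setoid R) using (_≈_)

    connect : (ps : List (A × A)) →
      ∃ λ (r : A → A) → (∀ x → x ≈ r x) ×
        (∀ {x y} → (x , y) ∈ ps → R x y → r x ≡ r y)
    connect [] = (λ x → x) , (λ _ → Cl.refl) , λ ()
    connect ((a , b) ∷ ps) with connect ps | R? a b
    ... | r , r-sound , r-joins | no ¬Rab =
          r , r-sound , λ where
            (here refl) Rab → contradiction Rab ¬Rab
            (there p)   Rxy → r-joins p Rxy
    ... | r , r-sound , r-joins | yes Rab =
          merge ∘ r , sound , λ where
            (here refl) _   → trans merge-a (sym merge-b)
            (there p)   Rxy → cong merge (r-joins p Rxy)
      where
      merge : A → A
      merge z with z ≟ r a
      ... | yes _ = r b
      ... | no  _ = z

      merge-a : merge (r a) ≡ r b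
      merge-a with r a ≟ r a
      ... | yes _  = refl
      ... | no neq = contradiction refl neq

      merge-b : merge (r b) ≡ r b
      merge-b with r b ≟ r a
      ... | yes _ = refl
      ... | no  _ = refl

      sound : ∀ x → x ≈ merge (r x)
      sound x with r x ≟ r a
      ... | no  _  = r-sound x
      ... | yes eq =
            Cl.trans (subst (x ≈_) eq (r-sound x))
              (Cl.trans (Cl.sym (r-sound a))
                (Cl.trans (Closure.return Rab) (r-sound b)))

  closure? : Decidable (EqClosure R)
  closure? x y with connect (List.cartesianProduct elements elements)
  ... | r , r-sound , r-joins = map′ to from (r x ≟ r y)
    where
    to : r x ≡ r y → x ≈ y
    to eq = Cl.trans (subst (x ≈_) eq (r-sound x)) (Cl.sym (r-sound y))
    from : x ≈ y → r x ≡ r y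
    from = Closure.gfold ≡.isEquivalence r
      (r-joins (∈-cartesianProduct⁺ (complete _) (complete _)))

  private
    representatives : (xs : List A) →
      ∃₂ λ m (rep : Fin m → A) →
        (∀ {i j} → rep i ≈ rep j → i ≡ j) × (∀ {x} → x ∈ xs → ∃ λ i → x ≈ rep i)
    representatives [] = 0 , (λ ()) , (λ {}) , λ ()
    representatives (x ∷ xs) with representatives xs
    ... | m , rep , inj , cover with Fin.any? (λ i → closure? x (rep i))
    ... | yes old = m , rep , inj , λ where
            (here refl) → old
            (there p)   → cover p
    ... | no new = suc m , rep′ , inj′ , λ where
            (here refl) → zero , Cl.refl
            (there p)   → let i , eq = cover p in suc i , eq
      where
      rep′ : Fin (suc m) → A
      rep′ zero    = x
      rep′ (suc i) = rep i
      inj′ : ∀ {i j} → rep′ i ≈ rep′ j → i ≡ j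
      inj′ {zero}  {zero}  _  = refl
      inj′ {zero}  {suc j} eq = contradiction (j , eq) new
      inj′ {suc i} {zero}  eq = contradiction (i , Cl.sym eq) new
      inj′ {suc i} {suc j} eq = cong suc (inj eq)

  countClasses : ∃ (HasClasses (Closure.setoid R))
  countClasses with representatives elements
  ... | m , rep , inj , cover = m , record
    { to        = λ x → proj₁ (class x)
    ; cong      = class-cong
    ; bijective = (λ {x} {y} eq →
          Cl.trans (subst (λ i → x ≈ rep i) eq (proj₂ (class x)))
            (Cl.sym (proj₂ (class y))))
        , λ i → rep i , λ {z} z≈rep →
            inj (Cl.trans (Cl.sym (proj₂ (class z))) z≈rep)
    }
    where
    class : ∀ x → ∃ λ i → x ≈ rep i
    class x = cover (complete x)
    class-cong : ∀ {x y} → x ≈ y → proj₁ (class x) ≡ proj₁ (class y)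
    class-cong {x} {y} x≈y =
      inj (Cl.trans (Cl.sym (proj₂ (class x))) (Cl.trans x≈y (proj₂ (class y))))

_≟ₚ_ : ∀ {n} → DecidableEquality (Perm n)
_≟ₚ_ = Refinement._≟_ (Vec.≡-dec ℕ._≟_)

private
  words : ℕ → ∀ n → List (Vec ℕ n)
  words N zero    = [] ∷ []
  words N (suc n) = List.cartesianProductWith _∷_ (List.upTo (suc N)) (words N n)

  ∈-words : ∀ {N n} {w : Vec ℕ n} → All (λ x → 1 ≤ x × x ≤ N) w → w ∈ words N n
  ∈-words []               = here refl
  ∈-words ((_ , x≤N) ∷ ps) =
    ∈-cartesianProductWith⁺ _∷_ (∈-upTo⁺ (s≤s x≤N)) (∈-words ps)

  toPerms : ∀ {n} → List (Vec ℕ n) → List (Perm n)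
  toPerms []       = []
  toPerms (w ∷ ws) with isPermutation? w
  ... | yes p = (w , [ p ]) ∷ toPerms ws
  ... | no  _ = toPerms ws

  ∈-toPerms : ∀ {n ws} {w : Vec ℕ n} (p : IsPermutation w) →
              w ∈ ws → (w , [ p ]) ∈ toPerms ws
  ∈-toPerms {ws = w ∷ _} p (here refl) with isPermutation? w
  ... | yes _ = here refl
  ... | no ¬p = contradiction p ¬p
  ∈-toPerms {ws = w ∷ _} p (there q) with isPermutation? w
  ... | yes _ = there (∈-toPerms p q)
  ... | no  _ = ∈-toPerms p q

isPerm : ∀ {n} (π : Perm n) → IsPermutation (value π)
isPerm (w , [ p ]) = recompute (isPermutation? w) p

perms : ∀ n → List (Perm n)
perms n = toPerms (words n n)

∈-perms : ∀ {n} (π : Perm n) → π ∈ perms n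
∈-perms π = ∈-toPerms (isPerm π) (∈-words (proj₁ (isPerm π)))

isOrderPermOf? : ∀ {c} → Decidable (_IsOrderPermOf_ {c})
isOrderPermOf? σ u = Fin.all? λ i → Fin.all? λ j →
  let P? = lookup (value σ) i ℕ.<? lookup (value σ) j
      Q? = lookup u i ℕ.<? lookup u j
  in map′ (λ (f , g) → mk⇔ f g) (λ e → Equivalence.to e , Equivalence.from e)
       ((P? →-dec Q?) ×-dec (Q? →-dec P?))

samePart? : ∀ {c} (K : Parts c) → Decidable (SamePart K)
samePart? K σ τ = (σ ≟ₚ τ) ⊎-dec
  Any.any? (λ part → Any.any? (σ ≟ₚ_) part ×-dec Any.any? (τ ≟ₚ_) part) K

private
  ∃? : ∀ {n} {P : Perm n → Set} → (∀ σ → Dec (P σ)) → Dec (∃ P)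
  ∃? P? = map′ (λ p → let σ , _ , Pσ = find p in σ , Pσ)
    (λ (σ , Pσ) → lose (∈-perms σ) Pσ) (Any.any? P? (perms _))

replaceable? : ∀ {c} (K : Parts c) → Decidable (Replaceable K)
replaceable? K u v = ∃? λ σ → ∃? λ τ →
  isOrderPermOf? σ u ×-dec isOrderPermOf? τ v ×-dec samePart? K σ τ

private
  splitAt? : ∀ c (xs : List ℕ) →
    Dec (∃₂ λ (u : Vec ℕ c) (b : List ℕ) → xs ≡ toList u ++ b)
  splitAt? zero    xs       = yes ([] , xs , refl)
  splitAt? (suc c) []       = no λ { (_ ∷ _ , _ , ()) }
  splitAt? (suc c) (x ∷ xs) = map′
    (λ { (u , b , refl) → x ∷ u , b , refl })
    (λ { (_ ∷ u , b , refl) → u , b , refl })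
    (splitAt? c xs)

  splitAt-unique : ∀ {c} (u u′ : Vec ℕ c) {b b′} →
    toList u ++ b ≡ toList u′ ++ b′ → u ≡ u′ × b ≡ b′
  splitAt-unique []      []        eq = refl , eq
  splitAt-unique (x ∷ u) (x′ ∷ u′) eq
    with refl , eq′ ← List.∷-injective eq
    with refl , refl ← splitAt-unique u u′ eq′ = refl , refl

  module _ {c} (K : Parts c) where

    ReplaceHead : Rel (List ℕ) 0ℓ
    ReplaceHead φ ψ = ∃ λ b → ∃₂ λ (u v : Vec ℕ c) →
      φ ≡ toList u ++ b × ψ ≡ toList v ++ b × Replaceable K u v

    replaceHead? : Decidable ReplaceHead
    replaceHead? φ ψ with splitAt? c φ | splitAt? c ψ
    ... | no ¬φ | _ = no λ (b , u , v , p , q , r) → ¬φ (u , b , p)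
    ... | yes _ | no ¬ψ = no λ (b , u , v , p , q , r) → ¬ψ (v , b , q)
    ... | yes (u , b , refl) | yes (v , b′ , refl) =
      map′ (λ { (refl , r) → b , u , v , refl , refl , r }) from
        (List.≡-dec ℕ._≟_ b b′ ×-dec replaceable? K u v)
      where
      from : ReplaceHead (toList u ++ b) (toList v ++ b′) →
             b ≡ b′ × Replaceable K u v
      from (_ , u₁ , v₁ , p , q , r)
        with refl , refl ← splitAt-unique u u₁ p
        with refl , refl ← splitAt-unique v v₁ q = refl , r

    ReplaceTail : Rel (List ℕ) 0ℓ
    ReplaceTail (x ∷ φ) (y ∷ ψ) = x ≡ y × ReplaceIn K φ ψ
    ReplaceTail _       _       = ⊥

    step-to : ∀ φ ψ → ReplaceHead φ ψ ⊎ ReplaceTail φ ψ → ReplaceIn K φ ψ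
    step-to _ _ (inj₁ (b , rest)) = [] , b , rest
    step-to (x ∷ _) (_ ∷ _) (inj₂ (refl , a , b , u , v , refl , refl , r)) =
      x ∷ a , b , u , v , refl , refl , r

    step-from : ∀ φ ψ → ReplaceIn K φ ψ → ReplaceHead φ ψ ⊎ ReplaceTail φ ψ
    step-from _ _ ([] , b , rest) = inj₁ (b , rest)
    step-from _ _ (_ ∷ a , b , u , v , refl , refl , r) =
      inj₂ (refl , a , b , u , v , refl , refl , r)

    replaceIn? : Decidable (ReplaceIn K)
    replaceTail? : Decidable ReplaceTail

    replaceIn? φ ψ = map′ (step-to φ ψ) (step-from φ ψ)
      (replaceHead? φ ψ ⊎-dec replaceTail? φ ψ)

    replaceTail? (x ∷ φ) (y ∷ ψ) = (x ℕ.≟ y) ×-dec replaceIn? φ ψ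
    replaceTail? []      _       = no λ ()
    replaceTail? (_ ∷ _) []      = no λ ()

classes : ∀ {c} (K : Parts c) n → ∃ (HasClasses (K-equivalence K n))
classes K n = countClasses _≟ₚ_ (perms n) ∈-perms
  (λ φ ψ → replaceIn? K (toList (value φ)) (toList (value ψ)))

numClasses : ∀ {c} → Parts c → ℕ → ℕ
numClasses K n = proj₁ (classes K n)

K₀ : Parts 3
K₀ = (perm (1 ∷ 2 ∷ 3 ∷ []) ∷ perm (1 ∷ 3 ∷ 2 ∷ []) ∷ [])
   ∷ (perm (2 ∷ 1 ∷ 3 ∷ []) ∷ perm (3 ∷ 1 ∷ 2 ∷ []) ∷ [])
   ∷ []

{-# OPTIONS --safe #-}

module Submission where

-- The smallest letter of a word keeps its position under every replacement:
-- in each window containing it, it is the letter that stays put, while two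
-- letters near it are exchanged. Around the smallest letter v a word
-- ... x v y z ... may exchange x with y and y with z, with no condition on
-- x, y, z. Hence, once v has been deleted, x, y and z may be permuted
-- freely. So the statement is generalised from permutations to words in which
-- each gap between neighbouring letters is either soft (the two letters may
-- be exchanged) or hard. A block is a maximal run of letters joined by soft
-- gaps.
--
-- For a given scheme of gaps, the block containing the smallest letter is an
-- invariant. Up to equivalence that letter may be moved to the last place of
-- its block; deleting it then deletes the hard gap at that end of the block
-- and softens the two gaps beside it, or, if the block ends the word, deletes
-- the last gap of the word and nothing else. The deletion takes equivalent
-- words to equivalent words (removal-move), and equivalences of the shorter
-- words lift back (insert-move). Iterating, the classes correspond to the
-- sequences of choices of blocks, the codes. All schemes below are listed from
-- the right end of the permutation, so words are read backwards.
--
-- The number N(G) of codes of a scheme G is the number for the tail of G plus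
-- the sum of the numbers for all schemes that arise from G by deleting one
-- hard gap and softening the gaps beside it. Writing S and H for soft and hard gaps, with a
-- soft gap by convention in front of the first letter, induction gives, for
-- every scheme Y and s at least 1,
--   N(S^s H S Y) = (s + 1) N(S^s S S Y),
--   N(S^s H H Y) = N(S^s S H Y) + s N(S^s S S Y)
-- (padded-hard-soft, padded-hard-hard). Put r(a, s) = N(S^s H^a). The second
-- identity reads r(a + 2, s) = r(a + 1, s + 1) + s r(a, s + 2): this expands a
-- continuant, a sum over the matchings of a path in which the edge from i to
-- i + 1 has weight i, at one end of the path. Expanding it at the other end
-- gives r(a + 2, s) = r(a + 1, s) + (s + a + 1) r(a, s), which for s = 1 is
-- the theorem, since f(n) = r(n - 1, 1).

open import Data.Fin.Base using (Fin; zero; suc)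
open import Data.Fin.Patterns using (0F; 1F; 2F)
import Data.Fin.Properties as Fin
open import Data.Irrelevant using ([_])
open import Data.List.Base as List using (List; []; _∷_; _++_; length; replicate; reverse)
open import Data.List.Membership.Propositional using (_∈_; _∉_)
open import Data.List.Membership.Propositional.Properties using (∈-∃++)
import Data.List.Properties as List
open import Data.List.Relation.Binary.Permutation.Propositional
  using (_↭_; prep; ↭-refl; ↭-sym; ↭-trans; ↭⇒↭ₛ)
  renaming (swap to ↭-swap)
open import Data.List.Relation.Binary.Permutation.Propositional.Properties
  using (All-resp-↭; ∈-resp-↭; ↭-length; ↭-empty-inv; drop-∷; shift; shifts; ++-comm; ↭-reverse)
import Data.List.Relation.Binary.Permutation.Setoid.Properties as ↭ₛ
open import Data.List.Relation.Unary.All as All using (All; []; _∷_)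
open import Data.List.Relation.Unary.AllPairs using ([]; _∷_)
open import Data.List.Relation.Unary.Any using (here; there)
open import Data.List.Relation.Unary.Unique.Propositional using (Unique)
open import Data.Nat.Base using (ℕ; zero; suc; _+_; _*_; _∸_; _≤_; _<_; s≤s; z≤n)
import Data.Nat.Properties as ℕ
open import Data.List.Membership.DecPropositional ℕ._≟_ using (_∈?_)
open import Data.Nat.Tactic.RingSolver using (solve-∀)
open import Data.Product.Base using (∃; ∃₂; _×_; _,_; proj₁; proj₂)
open import Data.Refinement.Base using (value) renaming (_,_ to _,ᵣ_)
open import Data.Sum.Base using (_⊎_; inj₁; inj₂)
open import Data.Sum.Function.Propositional using (_⊎-↔_)
open import Data.Vec.Base as Vec using (Vec; []; _∷_; lookup; toList)
import Data.Vec.Properties as Vec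
import Data.Vec.Relation.Unary.All.Properties as VAll
open import Data.Vec.Relation.Unary.AllPairs using ([]; _∷_)
import Data.Vec.Relation.Unary.Unique.Propositional as VUnique
open import Data.Vec.Relation.Unary.Unique.Propositional.Properties using (lookup-injective)
open import Function.Base using (_∘_)
open import Function.Bundles using (Equivalence; Inverse; _↔_; mk⇔; mk↔ₛ′)
open import Function.Construct.Composition using (_↔-∘_)
open import Function.Construct.Symmetry using (↔-sym)
open import Relation.Binary.Bundles using (Setoid)
import Relation.Binary.Construct.Closure.Equivalence as Closure
open import Relation.Binary.Construct.Closure.ReflexiveTransitive as Star
  using (Star; ε; _◅_; _◅◅_)
open import Relation.Binary.Construct.Closure.Symmetric using (fwd)
open import Relation.Binary.Definitions using (tri<; tri≈; tri>)
open import Relation.Binary.PropositionalEquality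
  using (_≡_; _≢_; refl; sym; trans; cong; cong₂; subst; subst₂; setoid; module ≡-Reasoning)
import Relation.Binary.PropositionalEquality.Properties as ≡
open import Relation.Nullary.Decidable using (yes; no)
open import Relation.Nullary.Negation using (contradiction)
open import Defs

-- Moves of words with soft and hard gaps

-- The two letters beside a soft gap may be exchanged, whatever they are.
data Gap : Set where
  soft hard : Gap

-- One gap in front of each letter of a word. The gap in front of the first
-- letter plays no role in the moves and is soft by convention.
Scheme : Set
Scheme = List Gap

soften : Scheme → Scheme
soften []      = []
soften (_ ∷ Y) = soft ∷ Y

private
  variable
    g h : Gap
    G Y Z : Scheme
    k m n v x y z : ℕ
    u u′ w w′ : List ℕ

-- The moves of a word with a given scheme, the gaps staying in place. Apart
-- from the exchanges across soft gaps, a letter v that begins a block, that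
-- is, has a hard gap in front of it, may serve as the smallest letter of an
-- exchange: two larger letters, the two in front of it or its two
-- neighbours, are exchanged. If all gaps are hard, these are the replacements
-- of K₀, read backwards. Only letters v that begin a block are admitted, as
-- otherwise the moves would not be compatible with those on the longer words
-- from which the scheme arises.
data Move : Scheme → List ℕ → List ℕ → Set where
  swap   : Move (g ∷ soft ∷ Y) (x ∷ y ∷ u) (y ∷ x ∷ u)
  before : v < x → v < y →
           Move (g ∷ h ∷ hard ∷ Y) (x ∷ y ∷ v ∷ u) (y ∷ x ∷ v ∷ u)
  around : v < x → v < y →
           Move (g ∷ hard ∷ h ∷ Y) (x ∷ v ∷ y ∷ u) (y ∷ v ∷ x ∷ u)
  skip   : Move Y u u′ → Move (g ∷ Y) (x ∷ u) (x ∷ u′)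

infix 4 _⊢_⟶*_
_⊢_⟶*_ : Scheme → List ℕ → List ℕ → Set
G ⊢ w ⟶* w′ = Star (Move G) w w′

Move-sym : Move G w w′ → Move G w′ w
Move-sym swap         = swap
Move-sym (before p q) = before q p
Move-sym (around p q) = around q p
Move-sym (skip s)     = skip (Move-sym s)

Move⇒↭ : Move G w w′ → w ↭ w′
Move⇒↭ swap         = ↭-swap _ _ ↭-refl
Move⇒↭ (before _ _) = ↭-swap _ _ ↭-refl
Move⇒↭ (around _ _) =
  ↭-trans (↭-swap _ _ ↭-refl) (↭-trans (prep _ (↭-swap _ _ ↭-refl)) (↭-swap _ _ ↭-refl))
Move⇒↭ (skip s)     = prep _ (Move⇒↭ s)

Move-rehead : Move (g ∷ Y) w w′ → Move (h ∷ Y) w w′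
Move-rehead swap         = swap
Move-rehead (before p q) = before p q
Move-rehead (around p q) = around p q
Move-rehead (skip s)     = skip s

Move-soften : Move Y w w′ → Move (soften Y) w w′
Move-soften {Y = _ ∷ _} s = Move-rehead s

Move-unsoften : Move (soften Y) w w′ → Move Y w w′
Move-unsoften {Y = _ ∷ _} s = Move-rehead s

one : Move G w w′ → G ⊢ w ⟶* w′
one s = s ◅ ε

skip* : Y ⊢ u ⟶* u′ → (g ∷ Y) ⊢ x ∷ u ⟶* x ∷ u′
skip* = Star.gmap _ skip

swap-ends : (g ∷ soft ∷ soft ∷ Y) ⊢ x ∷ v ∷ y ∷ u ⟶* y ∷ v ∷ x ∷ u
swap-ends = swap ◅ skip swap ◅ swap ◅ ε

-- If v does not begin its block, but lies directly behind y in it, the move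
-- before is still available: v and y can change places first.
swap-before : v < x → v < y →
  (g ∷ h ∷ soft ∷ Y) ⊢ x ∷ y ∷ v ∷ u ⟶* y ∷ x ∷ v ∷ u
swap-before {h = soft} p q = one swap
swap-before {h = hard} p q = skip swap ◅ around p q ◅ skip swap ◅ ε

-- Deleting the smallest letter

-- InnerCut g Y Z: the scheme Z arises from g ∷ Y by deleting one hard gap of
-- Y and softening the gaps on both sides of it.
data InnerCut : Gap → Scheme → Scheme → Set where
  here  : InnerCut g (hard ∷ Y) (soft ∷ soften Y)
  there : InnerCut h Y Z → InnerCut g (h ∷ Y) (g ∷ Z)

-- The possible schemes of the remaining word once the smallest letter has
-- been deleted, one for each block: either that letter lies in the first
-- block, or its block is named by the hard gap in front of it.
data Cut : Scheme → Scheme → Set where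
  first : Cut (g ∷ Y) (soften Y)
  inner : InnerCut g Y Z → Cut (g ∷ Y) Z

-- InFirstBlock m G w u: m lies in the first block of w, and deleting it
-- leaves u.
data InFirstBlock (m : ℕ) : Scheme → List ℕ → List ℕ → Set where
  here  : InFirstBlock m (g ∷ Y) (m ∷ u) u
  there : InFirstBlock m (soft ∷ Y) w u →
          InFirstBlock m (g ∷ soft ∷ Y) (x ∷ w) (x ∷ u)

-- InInnerBlock m c w u: m lies in the block whose front gap is deleted by c,
-- and deleting m leaves u.
data InInnerBlock (m : ℕ) : InnerCut g Y Z → List ℕ → List ℕ → Set where
  here  : InFirstBlock m (hard ∷ Y) w u →
          InInnerBlock m (here {g} {Y}) (x ∷ w) (x ∷ u)
  there : {c : InnerCut h Y Z} → InInnerBlock m c w u →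
          InInnerBlock m (there {g = g} c) (x ∷ w) (x ∷ u)

data Removal (m : ℕ) : Cut G Z → List ℕ → List ℕ → Set where
  first : InFirstBlock m (g ∷ Y) w u → Removal m (first {g} {Y}) w u
  inner : {c : InnerCut g Y Z} → InInnerBlock m c w u → Removal m (inner c) w u

private
  asym : ∀ {A : Set} → m < v → v < m → A
  asym p q = contradiction q (ℕ.<-asym p)

-- A move involving the smallest letter m keeps m in its block; after the
-- deletion of m it is trivial or an exchange across a soft gap. Any other move
-- remains possible, if need be as a sequence of moves.
firstBlock-move : InFirstBlock m (g ∷ Y) w u → All (m <_) u →
  Move (g ∷ Y) w w′ → ∃ λ u′ → InFirstBlock m (g ∷ Y) w′ u′ × Y ⊢ u ⟶* u′
firstBlock-move here a swap = _ , there here , ε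
firstBlock-move here (_ ∷ q ∷ _) (before p _) = asym q p
firstBlock-move here (q ∷ _) (around p _) = asym q p
firstBlock-move here a (skip s) = _ , here , one s
firstBlock-move (there here) a swap = _ , here , ε
firstBlock-move (there (there r)) a swap = _ , there (there r) , one swap
firstBlock-move (there here) (_ ∷ q ∷ _) (before _ p) = asym q p
firstBlock-move (there r) (_ ∷ a) (skip s)
  with firstBlock-move r a s
... | _ , r′ , t = _ , there r′ , skip* t

innerBlock-move : {c : InnerCut g Y Z} → InInnerBlock m c w u → All (m <_) u →
  Move (g ∷ Y) w w′ → ∃ λ u′ → InInnerBlock m c w′ u′ × Z ⊢ u ⟶* u′
innerBlock-move (here here) (_ ∷ q ∷ _) (before _ p) = asym q p
innerBlock-move (here here) a (around _ _) = _ , here here , one swap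
innerBlock-move (here (there here)) (_ ∷ q ∷ _) (around _ p) = asym q p
innerBlock-move (here (there (there r))) a (around _ _) =
  _ , here (there (there r)) , swap-ends
innerBlock-move (here {Y = Y} r) (_ ∷ a) (skip s)
  with firstBlock-move r a s
... | _ , r′ , t = _ , here r′ , skip* (Star.map Move-soften t)
innerBlock-move (there (here r)) a swap = _ , there (here r) , one swap
innerBlock-move (there (there r)) a swap = _ , there (there r) , one swap
innerBlock-move (there (here here)) a (before _ _) = _ , there (here here) , one swap
innerBlock-move (there (here (there r))) a (before _ _) =
  _ , there (here (there r)) , one swap
innerBlock-move (there (there (here r))) a (before p q) =
  _ , there (there (here r)) , swap-before p q
innerBlock-move (there (there (there r))) a (before p q) =
  _ , there (there (there r)) , one (before p q)
innerBlock-move (there (here here)) (_ ∷ q ∷ _) (around _ p) = asym q p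
innerBlock-move (there (here (there r))) a (around _ _) =
  _ , there (here (there r)) , swap-ends
innerBlock-move (there (there (here r))) a (around p q) =
  _ , there (there (here r)) , one (around p q)
innerBlock-move (there (there (there r))) a (around p q) =
  _ , there (there (there r)) , one (around p q)
innerBlock-move (there r) (_ ∷ a) (skip s)
  with innerBlock-move r a s
... | _ , r′ , t = _ , there r′ , skip* t

removal-move : {c : Cut G Z} → Removal m c w u → All (m <_) u →
  Move G w w′ → ∃ λ u′ → Removal m c w′ u′ × Z ⊢ u ⟶* u′
removal-move (first r) a s with firstBlock-move r a s
... | _ , r′ , t = _ , first r′ , Star.map Move-soften t
removal-move (inner r) a s with innerBlock-move r a s
... | _ , r′ , t = _ , inner r′ , t

-- Codes of words

-- A code for a scheme of n gaps: the cuts made when n letters are deleted one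
-- by one in increasing order.
data Code : ℕ → Scheme → Set where
  done : Code 0 []
  _∷_  : Cut G Z → Code n Z → Code (suc n) G

-- HasCode k c w: w consists of the letters k, ..., k + n - 1, and deleting
-- them in this order makes the cuts of c.
data HasCode : ℕ → Code n G → List ℕ → Set where
  done : HasCode k done []
  _∷_  : {c : Cut G Z} {d : Code n Z} → Removal k c w u →
         HasCode (suc k) d u → HasCode k (c ∷ d) w

-- The list k, k + 1, ..., k + n - 1.
interval : ℕ → ℕ → List ℕ
interval k zero    = []
interval k (suc n) = k ∷ interval (suc k) n

All-interval : ∀ k n → All (λ x → k ≤ x × x < k + n) (interval k n)
All-interval k zero    = []
All-interval k (suc n) =
  (ℕ.≤-refl , ℕ.m<m+n k (s≤s z≤n)) ∷
  All.map (λ {x} (p , q) → ℕ.<⇒≤ p , subst (x <_) (sym (ℕ.+-suc k n)) q)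
    (All-interval (suc k) n)

firstBlock-↭ : InFirstBlock m G w u → w ↭ m ∷ u
firstBlock-↭ here      = ↭-refl
firstBlock-↭ (there r) = ↭-trans (prep _ (firstBlock-↭ r)) (↭-swap _ _ ↭-refl)

innerBlock-↭ : {c : InnerCut g Y Z} → InInnerBlock m c w u → w ↭ m ∷ u
innerBlock-↭ (here r)  = ↭-trans (prep _ (firstBlock-↭ r)) (↭-swap _ _ ↭-refl)
innerBlock-↭ (there r) = ↭-trans (prep _ (innerBlock-↭ r)) (↭-swap _ _ ↭-refl)

removal-↭ : {c : Cut G Z} → Removal m c w u → w ↭ m ∷ u
removal-↭ (first r) = firstBlock-↭ r
removal-↭ (inner r) = innerBlock-↭ r

hasCode-↭ : {c : Code n G} → HasCode k c w → w ↭ interval k n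
hasCode-↭ done    = ↭-refl
hasCode-↭ (r ∷ q) = ↭-trans (removal-↭ r) (prep _ (hasCode-↭ q))

hasCode-≥ : {c : Code n G} → HasCode k c w → All (k ≤_) w
hasCode-≥ {n = n} {k = k} q =
  All-resp-↭ (↭-sym (hasCode-↭ q)) (All.map proj₁ (All-interval k n))

mutual
  hasCode-move : {c : Code n G} → HasCode k c w → Move G w w′ → HasCode k c w′
  hasCode-move (r ∷ q) s with removal-move r (hasCode-≥ q) s
  ... | _ , r′ , t = r′ ∷ hasCode-moves q t

  hasCode-moves : {c : Code n G} → HasCode k c w → G ⊢ w ⟶* w′ → HasCode k c w′
  hasCode-moves q ε       = q
  hasCode-moves q (s ◅ t) = hasCode-moves (hasCode-move q s) t

firstBlock-unique : InFirstBlock m G w u → InFirstBlock m G w u′ →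
  All (m <_) u → All (m <_) u′ → u ≡ u′
firstBlock-unique here here _ _ = refl
firstBlock-unique here (there r) _ (p ∷ _) = contradiction p (ℕ.<-irrefl refl)
firstBlock-unique (there r) here (p ∷ _) _ = contradiction p (ℕ.<-irrefl refl)
firstBlock-unique (there r) (there r′) (_ ∷ a) (_ ∷ a′) =
  cong (_ ∷_) (firstBlock-unique r r′ a a′)

first-inner-disjoint : {A : Set} {c : InnerCut g Y Z} → InFirstBlock m (g ∷ Y) w u →
  InInnerBlock m c w u′ → All (m <_) u → All (m <_) u′ → A
first-inner-disjoint here (here _) _ (p ∷ _) = contradiction p (ℕ.<-irrefl refl)
first-inner-disjoint here (there _) _ (p ∷ _) = contradiction p (ℕ.<-irrefl refl)
first-inner-disjoint (there r) (there r′) (_ ∷ a) (_ ∷ a′) = first-inner-disjoint r r′ a a′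

innerBlock-unique : ∀ {Z′} {c : InnerCut g Y Z} {c′ : InnerCut g Y Z′} →
  InInnerBlock m c w u → InInnerBlock m c′ w u′ →
  All (m <_) u → All (m <_) u′ →
  _≡_ {A = ∃ λ Z → InnerCut g Y Z × List ℕ} (Z , c , u) (Z′ , c′ , u′)
innerBlock-unique (here r) (here r′) (_ ∷ a) (_ ∷ a′)
  with refl ← firstBlock-unique r r′ a a′ = refl
innerBlock-unique (here r) (there r′) (_ ∷ a) (_ ∷ a′) = first-inner-disjoint r r′ a a′
innerBlock-unique (there r) (here r′) (_ ∷ a) (_ ∷ a′) = first-inner-disjoint r′ r a′ a
innerBlock-unique (there r) (there r′) (_ ∷ a) (_ ∷ a′)
  with refl ← innerBlock-unique r r′ a a′ = refl

removal-unique : ∀ {Z′} {c : Cut G Z} {c′ : Cut G Z′} →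
  Removal m c w u → Removal m c′ w u′ →
  All (m <_) u → All (m <_) u′ →
  _≡_ {A = ∃ λ Z → Cut G Z × List ℕ} (Z , c , u) (Z′ , c′ , u′)
removal-unique (first r) (first r′) a a′ with refl ← firstBlock-unique r r′ a a′ = refl
removal-unique (first r) (inner r′) a a′ = first-inner-disjoint r r′ a a′
removal-unique (inner r) (first r′) a a′ = first-inner-disjoint r′ r a′ a
removal-unique (inner r) (inner r′) a a′ with refl ← innerBlock-unique r r′ a a′ = refl

hasCode-unique : {c c′ : Code n G} → HasCode k c w → HasCode k c′ w → c ≡ c′
hasCode-unique done done = refl
hasCode-unique (r ∷ q) (r′ ∷ q′)
  with refl ← removal-unique r r′ (hasCode-≥ q) (hasCode-≥ q′) =
  cong (_ ∷_) (hasCode-unique q q′)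

-- The insertion of m as the first letter of the block named by a cut. On
-- words too short for the cut the value is irrelevant.
insertInner : InnerCut g Y Z → ℕ → List ℕ → List ℕ
insertInner c         m []      = m ∷ []
insertInner here      m (x ∷ u) = x ∷ m ∷ u
insertInner (there c) m (x ∷ u) = x ∷ insertInner c m u

insert : Cut G Z → ℕ → List ℕ → List ℕ
insert first     m u = m ∷ u
insert (inner c) m u = insertInner c m u

firstBlock-insert : InFirstBlock m (g ∷ Y) w u → (g ∷ Y) ⊢ w ⟶* m ∷ u
firstBlock-insert here      = ε
firstBlock-insert (there r) = skip* (firstBlock-insert r) ◅◅ one swap

innerBlock-insert : {c : InnerCut g Y Z} → InInnerBlock m c w u →
  (g ∷ Y) ⊢ w ⟶* insertInner c m u
innerBlock-insert (here r)  = skip* (firstBlock-insert r)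
innerBlock-insert (there r) = skip* (innerBlock-insert r)

removal-insert : {c : Cut G Z} → Removal m c w u → G ⊢ w ⟶* insert c m u
removal-insert (first r) = firstBlock-insert r
removal-insert (inner r) = innerBlock-insert r

-- When m is deleted from z x m y, the gaps between z and x and between x and
-- y become soft. Exchanges across these two gaps lift to moves that use m as
-- the smallest letter. So does a move before that exchanges x and y. All other
-- moves lift unchanged, since the letter v in them has a hard gap in front.
insertInner-move : (c : InnerCut g Y Z) → All (m <_) u → Move Z u u′ →
  Move (g ∷ Y) (insertInner c m u) (insertInner c m u′)
insertInner-move (here {Y = []})    _ (skip ())
insertInner-move (here {Y = _ ∷ _}) (p ∷ q ∷ _) swap = around p q
insertInner-move (here {Y = _ ∷ _}) (p ∷ q ∷ _) (before _ _) = around p q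
insertInner-move (here {Y = _ ∷ _}) (p ∷ a) (skip s) = skip (skip (Move-rehead s))
insertInner-move (there (here {Y = []}))    (p ∷ q ∷ _) swap = before p q
insertInner-move (there (here {Y = _ ∷ _})) (p ∷ q ∷ _) swap = before p q
insertInner-move (there (there c))         _ swap           = swap
insertInner-move (there (there (there c))) _ (before p q)   = before p q
insertInner-move (there (there here))      _ (around p q)   = around p q
insertInner-move (there (there (there c))) _ (around p q)   = around p q
insertInner-move (there c) (_ ∷ a) (skip s) = skip (insertInner-move c a s)

insert-move : (c : Cut G Z) → All (m <_) u → Move Z u u′ →
  Move G (insert c m u) (insert c m u′)
insert-move first     a s = skip (Move-unsoften s)
insert-move (inner c) a s = insertInner-move c a s

insert-moves : (c : Cut G Z) → All (m <_) u → Z ⊢ u ⟶* u′ →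
  G ⊢ insert c m u ⟶* insert c m u′
insert-moves c a ε       = ε
insert-moves c a (s ◅ t) =
  insert-move c a s ◅ insert-moves c (All-resp-↭ (Move⇒↭ s) a) t

hasCode⇒moves : {c : Code n G} → HasCode k c w → HasCode k c w′ → G ⊢ w ⟶* w′
hasCode⇒moves done done = ε
hasCode⇒moves (_∷_ {c = c} r q) (r′ ∷ q′) =
  removal-insert r
    ◅◅ insert-moves c (hasCode-≥ q) (hasCode⇒moves q q′)
    ◅◅ Star.reverse Move-sym (removal-insert r′)

insertInner-removal : (c : InnerCut g Y Z) → length u ≡ length Z →
  InInnerBlock m c (insertInner c m u) u
insertInner-removal {u = _ ∷ _} here      _ = here here
insertInner-removal {u = _ ∷ _} (there c) e =
  there (insertInner-removal c (cong (_∸ 1) e))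

insert-removal : (c : Cut G Z) → length u ≡ length Z → Removal m c (insert c m u) u
insert-removal first     _ = first here
insert-removal (inner c) e = inner (insertInner-removal c e)

cutInner-length : InnerCut g Y Z → length Y ≡ length Z
cutInner-length (here {Y = []})    = refl
cutInner-length (here {Y = _ ∷ _}) = refl
cutInner-length (there c)          = cong suc (cutInner-length c)

soften-length : ∀ Y → length (soften Y) ≡ length Y
soften-length []      = refl
soften-length (_ ∷ _) = refl

cut-length : Cut G Z → length G ≡ suc (length Z)
cut-length (first {Y = Y}) = cong suc (sym (soften-length Y))
cut-length (inner c)       = cong suc (cutInner-length c)

hasCode-length : {c : Code n G} → HasCode k c w → length w ≡ length G
hasCode-length done              = refl
hasCode-length (_∷_ {c = c} r q) =
  trans (↭-length (removal-↭ r)) (trans (cong suc (hasCode-length q)) (sym (cut-length c)))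

hasCode-exists : (c : Code n G) → ∀ k → ∃ (HasCode k c)
hasCode-exists done    k = [] , done
hasCode-exists (c ∷ d) k =
  let u , q = hasCode-exists d (suc k)
  in insert c k u , insert-removal c (hasCode-length q) ∷ q

interval-length : ∀ k n → length (interval k n) ≡ n
interval-length k zero    = refl
interval-length k (suc n) = cong suc (interval-length (suc k) n)

removal-exists : ∀ g Y {w} → length w ≡ suc (length Y) → m ∈ w →
  ∃₂ λ Z (c : Cut (g ∷ Y) Z) → ∃ λ u → Removal m c w u
removal-exists g Y       e (here refl) = _ , _ , _ , first here
removal-exists g []      e (there {xs = []} ())
removal-exists g (soft ∷ Y) e (there i) with removal-exists soft Y (cong (_∸ 1) e) i
... | _ , _ , _ , first r = _ , _ , _ , first (there r)
... | _ , _ , _ , inner r = _ , _ , _ , inner (there r)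
removal-exists g (hard ∷ Y) e (there i) with removal-exists hard Y (cong (_∸ 1) e) i
... | _ , _ , _ , first r = _ , _ , _ , inner (here r)
... | _ , _ , _ , inner r = _ , _ , _ , inner (there r)

hasCode-total : ∀ n G → length G ≡ n → w ↭ interval k n →
  ∃ λ (c : Code n G) → HasCode k c w
hasCode-total zero [] _ p with refl ← ↭-empty-inv p = done , done
hasCode-total {k = k} (suc n) (g ∷ Y) e p
  with Z , c , u , r ← removal-exists g Y
         (trans (↭-length p) (trans (cong suc (interval-length (suc k) n)) (sym e)))
         (∈-resp-↭ (↭-sym p) (here refl))
  with d , q ← hasCode-total n Z (ℕ.suc-injective (trans (sym (cut-length c)) e))
                 (drop-∷ (↭-trans (↭-sym (removal-↭ r)) p)) =
  c ∷ d , r ∷ q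

-- The number of codes

-- The sum of f over the inner cuts of g ∷ Y.
sumInner : (Scheme → ℕ) → Gap → Scheme → ℕ
sumInner f g []         = 0
sumInner f g (soft ∷ Y) = sumInner (f ∘ (g ∷_)) soft Y
sumInner f g (hard ∷ Y) = f (soft ∷ soften Y) + sumInner (f ∘ (g ∷_)) hard Y

-- The number of codes; the equations for a number of letters different from
-- the length of the scheme say that there are none.
countCodes : ℕ → Scheme → ℕ
countCodes zero    []      = 1
countCodes zero    (_ ∷ _) = 0
countCodes (suc n) []      = 0
countCodes (suc n) (g ∷ Y) = countCodes n (soften Y) + sumInner (countCodes n) g Y

innerCuts↔ : ∀ {P : Scheme → Set} {f} → (∀ Z → P Z ↔ Fin (f Z)) → ∀ g Y →
  (∃ λ Z → InnerCut g Y Z × P Z) ↔ Fin (sumInner f g Y)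
innerCuts↔ P↔ g [] = mk↔ₛ′ (λ { (_ , () , _) }) (λ ()) (λ ()) (λ { (_ , () , _) })
innerCuts↔ P↔ g (soft ∷ Y) =
  innerCuts↔ (λ Z → P↔ (g ∷ Z)) soft Y ↔-∘
  mk↔ₛ′ (λ { (_ , there c , p) → _ , c , p }) (λ (Z , c , p) → g ∷ Z , there c , p)
        (λ _ → refl) (λ { (_ , there _ , _) → refl })
innerCuts↔ P↔ g (hard ∷ Y) =
  ↔-sym Fin.+↔⊎ ↔-∘
  ((P↔ _ ⊎-↔ innerCuts↔ (λ Z → P↔ (g ∷ Z)) hard Y) ↔-∘
  mk↔ₛ′ (λ { (_ , here , p) → inj₁ p ; (_ , there c , p) → inj₂ (_ , c , p) })
        (λ { (inj₁ p) → _ , here , p ; (inj₂ (Z , c , p)) → g ∷ Z , there c , p })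
        (λ { (inj₁ _) → refl ; (inj₂ _) → refl })
        (λ { (_ , here , _) → refl ; (_ , there _ , _) → refl }))

codes↔ : ∀ n G → Code n G ↔ Fin (countCodes n G)
codes↔ zero [] =
  mk↔ₛ′ (λ _ → zero) (λ _ → done) (λ { zero → refl }) (λ { done → refl })
codes↔ zero    (_ ∷ _) = mk↔ₛ′ (λ ()) (λ ()) (λ ()) (λ ())
codes↔ (suc n) []      = mk↔ₛ′ (λ { (() ∷ _) }) (λ ()) (λ ()) (λ { (() ∷ _) })
codes↔ (suc n) (g ∷ Y) =
  ↔-sym Fin.+↔⊎ ↔-∘
  ((codes↔ n (soften Y) ⊎-↔ innerCuts↔ (codes↔ n) g Y) ↔-∘
  mk↔ₛ′ (λ { (first ∷ d) → inj₁ d ; (inner c ∷ d) → inj₂ (_ , c , d) })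
        (λ { (inj₁ d) → first ∷ d ; (inj₂ (_ , c , d)) → inner c ∷ d })
        (λ { (inj₁ _) → refl ; (inj₂ _) → refl })
        (λ { (first ∷ _) → refl ; (inner _ ∷ _) → refl }))

-- The scheme Y preceded by s soft gaps.
pad : ℕ → Scheme → Scheme
pad zero    Y = Y
pad (suc s) Y = soft ∷ pad s Y

pad-shift : ∀ s Y → pad s (soft ∷ Y) ≡ soft ∷ pad s Y
pad-shift zero    Y = refl
pad-shift (suc s) Y = cong (soft ∷_) (pad-shift s Y)

soften-pad : ∀ s Y → soften (pad s (soft ∷ Y)) ≡ pad s (soft ∷ Y)
soften-pad zero    Y = refl
soften-pad (suc s) Y = refl

sumInner-pad : ∀ f s Y → sumInner f soft (pad s Y) ≡ sumInner (f ∘ pad s) soft Y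
sumInner-pad f zero    Y = refl
sumInner-pad f (suc s) Y = sumInner-pad (f ∘ (soft ∷_)) s Y

module _ (m : ℕ) where
  sumInner-linear : ∀ {a b c : Scheme → ℕ} → (∀ Z → a Z ≡ b Z + m * c Z) →
    ∀ g Y → sumInner a g Y ≡ sumInner b g Y + m * sumInner c g Y
  sumInner-linear eq g [] = sym (ℕ.*-zeroʳ m)
  sumInner-linear eq g (soft ∷ Y) = sumInner-linear (eq ∘ (g ∷_)) soft Y
  sumInner-linear {a} {b} {c} eq g (hard ∷ Y) =
    trans (cong₂ _+_ (eq _) (sumInner-linear (eq ∘ (g ∷_)) hard Y))
      (lemma m (b (soft ∷ soften Y)) (c (soft ∷ soften Y)) _ _)
    where
    lemma : ∀ m x y z w → (x + m * y) + (z + m * w) ≡ (x + z) + m * (y + w)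
    lemma = solve-∀

  sumInner-scale : ∀ {a c : Scheme → ℕ} → (∀ Z → a Z ≡ m * c Z) →
    ∀ g Y → sumInner a g Y ≡ m * sumInner c g Y
  sumInner-scale eq g []         = sym (ℕ.*-zeroʳ m)
  sumInner-scale eq g (soft ∷ Y) = sumInner-scale (eq ∘ (g ∷_)) soft Y
  sumInner-scale eq g (hard ∷ Y) =
    trans (cong₂ _+_ (eq _) (sumInner-scale (eq ∘ (g ∷_)) hard Y)) (sym (ℕ.*-distribˡ-+ m _ _))

  sumInner-scale-soft : ∀ {a c : Scheme → ℕ} → (∀ Z → a (soft ∷ Z) ≡ m * c (soft ∷ Z)) →
    ∀ Y → sumInner a soft Y ≡ m * sumInner c soft Y
  sumInner-scale-soft eq []         = sym (ℕ.*-zeroʳ m)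
  sumInner-scale-soft eq (soft ∷ Y) = sumInner-scale eq soft Y
  sumInner-scale-soft eq (hard ∷ Y) =
    trans (cong₂ _+_ (eq _) (sumInner-scale eq hard Y)) (sym (ℕ.*-distribˡ-+ m _ _))

-- The number of codes of Z preceded by s + 1 soft gaps, of which the first is
-- the conventional one in front of the first letter. The numbers s in the
-- following identities are thus one less than the lengths of the soft runs.
padded : ℕ → ℕ → Scheme → ℕ
padded n s Z = countCodes n (soft ∷ pad s Z)

padded-step : ∀ n s Z →
  padded (suc n) s Z ≡ countCodes n (soften (pad s Z)) + sumInner (countCodes n ∘ pad s) soft Z
padded-step n s Z = cong (countCodes n (soften (pad s Z)) +_) (sumInner-pad (countCodes n) s Z)

padded-shift : ∀ n s Z → countCodes n (pad s (soft ∷ Z)) ≡ padded n s Z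
padded-shift n s Z = cong (countCodes n) (pad-shift s Z)

padded-suc : ∀ n s Z → padded n s (soft ∷ Z) ≡ padded n (suc s) Z
padded-suc n s Z = cong (λ G → countCodes n (soft ∷ G)) (pad-shift s Z)

-- Deleting a letter of the first block shortens its soft run by one, cutting
-- at the displayed hard gap leaves s + 2 soft gaps followed by Y, and the cuts
-- inside Y are the same on both sides.
padded-hard-soft : ∀ n s Y → padded n s (hard ∷ soft ∷ Y) ≡ (2 + s) * padded n s (soft ∷ soft ∷ Y)
padded-hard-soft zero    s Y = sym (ℕ.*-zeroʳ s)
padded-hard-soft (suc n) s Y = begin
  padded (suc n) s (hard ∷ soft ∷ Y)
    ≡⟨ padded-step n s _ ⟩
  countCodes n (soften (pad s (hard ∷ soft ∷ Y)))
    + (N (soft ∷ soft ∷ Y) + sumInner (N ∘ (soft ∷_) ∘ (hard ∷_)) soft Y)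
    ≡⟨ cong₂ (λ p q → p + (N (soft ∷ soft ∷ Y) + q)) (tail n s)
         (sumInner-scale-soft (2 + s) inner-step Y) ⟩
  (1 + s) * N (soft ∷ soft ∷ Y)
    + (N (soft ∷ soft ∷ Y) + (2 + s) * rest)
    ≡⟨ collect s (N (soft ∷ soft ∷ Y)) rest ⟩
  (2 + s) * (N (soft ∷ soft ∷ Y) + rest)
    ≡⟨ cong (λ p → (2 + s) * (p + rest)) (cong (countCodes n) (soften-pad s _)) ⟨
  (2 + s) * (countCodes n (soften (pad s (soft ∷ soft ∷ Y))) + rest)
    ≡⟨ cong ((2 + s) *_) (padded-step n s _) ⟨
  (2 + s) * padded (suc n) s (soft ∷ soft ∷ Y) ∎
  where
  open ≡-Reasoning
  N : Scheme → ℕ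
  N = countCodes n ∘ pad s
  rest : ℕ
  rest = sumInner (N ∘ (soft ∷_) ∘ (soft ∷_)) soft Y
  inner-step : ∀ Z → N (soft ∷ hard ∷ soft ∷ Z) ≡ (2 + s) * N (soft ∷ soft ∷ soft ∷ Z)
  inner-step Z = trans (padded-shift n s _)
    (trans (padded-hard-soft n s Z) (cong ((2 + s) *_) (sym (padded-shift n s _))))
  tail : ∀ n s → countCodes n (soften (pad s (hard ∷ soft ∷ Y)))
         ≡ (1 + s) * countCodes n (pad s (soft ∷ soft ∷ Y))
  tail n zero    = sym (ℕ.+-identityʳ _)
  tail n (suc s) = padded-hard-soft n s Y
  collect : ∀ s x y → (1 + s) * x + (x + (2 + s) * y) ≡ (2 + s) * (x + y)
  collect = solve-∀

-- The cuts inside Y correspond to each other by induction, except that the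
-- cut at a hard gap at the very front of Y softens the second displayed gap on
-- the left-hand side; there padded-hard-soft applies.
padded-hard-hard : ∀ n s Y → padded n s (hard ∷ hard ∷ Y)
  ≡ padded n s (soft ∷ hard ∷ Y) + (1 + s) * padded n s (soft ∷ soft ∷ Y)
padded-hard-hard zero    s Y = sym (ℕ.*-zeroʳ s)
padded-hard-hard (suc n) s Y = begin
  padded (suc n) s (hard ∷ hard ∷ Y)
    ≡⟨ padded-step n s _ ⟩
  countCodes n (soften (pad s (hard ∷ hard ∷ Y)))
    + (N (soft ∷ soft ∷ Y)
    + (N (soft ∷ soft ∷ soften Y) + sumInner (N ∘ (soft ∷_) ∘ (hard ∷_)) hard Y))
    ≡⟨ cong₂ (λ p q → p + (N (soft ∷ soft ∷ Y) + (N (soft ∷ soft ∷ soften Y) + q)))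
         (tail n s) (inner-sum Y) ⟩
  (N (soft ∷ hard ∷ Y) + s * N (soft ∷ soft ∷ Y))
    + (N (soft ∷ soft ∷ Y) + (N (soft ∷ soft ∷ soften Y) + (restₕ + (1 + s) * restₛ)))
    ≡⟨ collect s (N (soft ∷ hard ∷ Y)) (N (soft ∷ soft ∷ Y))
         (N (soft ∷ soft ∷ soften Y)) restₕ restₛ ⟩
  (N (soft ∷ hard ∷ Y) + (N (soft ∷ soft ∷ soften Y) + restₕ))
    + (1 + s) * (N (soft ∷ soft ∷ Y) + restₛ)
    ≡⟨ cong₂ (λ p q → (p + (N (soft ∷ soft ∷ soften Y) + restₕ)) + (1 + s) * (q + restₛ))
         (cong (countCodes n) (soften-pad s _)) (cong (countCodes n) (soften-pad s _)) ⟨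
  (countCodes n (soften (pad s (soft ∷ hard ∷ Y)))
    + (N (soft ∷ soft ∷ soften Y) + restₕ))
    + (1 + s) * (countCodes n (soften (pad s (soft ∷ soft ∷ Y))) + restₛ)
    ≡⟨ cong₂ (λ p q → p + (1 + s) * q) (padded-step n s _) (padded-step n s _) ⟨
  padded (suc n) s (soft ∷ hard ∷ Y) + (1 + s) * padded (suc n) s (soft ∷ soft ∷ Y) ∎
  where
  open ≡-Reasoning
  N : Scheme → ℕ
  N = countCodes n ∘ pad s
  restₛ restₕ : ℕ
  restₛ = sumInner (N ∘ (soft ∷_) ∘ (soft ∷_)) soft Y
  restₕ = sumInner (N ∘ (soft ∷_) ∘ (soft ∷_)) hard Y
  tail : ∀ n s → countCodes n (soften (pad s (hard ∷ hard ∷ Y)))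
    ≡ countCodes n (pad s (soft ∷ hard ∷ Y)) + s * countCodes n (pad s (soft ∷ soft ∷ Y))
  tail n zero    = sym (ℕ.+-identityʳ _)
  tail n (suc s) = padded-hard-hard n s Y
  hardhard : ∀ Z → N (soft ∷ hard ∷ hard ∷ Z)
    ≡ N (soft ∷ soft ∷ hard ∷ Z) + (1 + s) * N (soft ∷ soft ∷ soft ∷ Z)
  hardhard Z = trans (padded-shift n s _) (trans (padded-hard-hard n s Z)
    (sym (cong₂ (λ p q → p + (1 + s) * q) (padded-shift n s _) (padded-shift n s _))))
  hardsoft : ∀ Z → N (soft ∷ hard ∷ soft ∷ Z) ≡ (2 + s) * N (soft ∷ soft ∷ soft ∷ Z)
  hardsoft Z = trans (padded-shift n s _)
    (trans (padded-hard-soft n s Z) (cong ((2 + s) *_) (sym (padded-shift n s _))))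
  inner-sum : ∀ Y → sumInner (N ∘ (soft ∷_) ∘ (hard ∷_)) hard Y
    ≡ sumInner (N ∘ (soft ∷_) ∘ (soft ∷_)) hard Y
      + (1 + s) * sumInner (N ∘ (soft ∷_) ∘ (soft ∷_)) soft Y
  inner-sum []         = sym (ℕ.*-zeroʳ (1 + s))
  inner-sum (soft ∷ Y) = sumInner-linear (1 + s) hardhard soft Y
  inner-sum (hard ∷ Y) =
    trans (cong₂ _+_ (hardsoft (soften Y)) (sumInner-linear (1 + s) hardhard hard Y))
      (regroup s (N (soft ∷ soft ∷ soft ∷ soften Y)) _ _)
    where
    regroup : ∀ s x y z → (2 + s) * x + (y + (1 + s) * z) ≡ (x + y) + (1 + s) * (x + z)
    regroup = solve-∀
  collect : ∀ s x y z p q → (x + s * y) + (y + (z + (p + (1 + s) * q)))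
    ≡ (x + (z + p)) + (1 + s) * (y + q)
  collect = solve-∀

-- The number of codes of a scheme of s + 1 soft gaps followed by a hard ones.
runCount : ℕ → ℕ → ℕ
runCount a s = padded (suc (s + a)) s (replicate a hard)

runCount-zero : ∀ s → runCount 0 s ≡ 1
runCount-zero zero    = refl
runCount-zero (suc s) = trans
  (cong₂ _+_ (runCount-zero s) (sumInner-pad (countCodes (suc (s + 0))) (suc s) []))
  (ℕ.+-identityʳ 1)

runCount-one : ∀ s → runCount 1 s ≡ 2 + s
runCount-one zero    = refl
runCount-one (suc s) = begin
  padded (2 + s + 1) (suc s) (hard ∷ [])
    ≡⟨ padded-step (1 + s + 1) (suc s) (hard ∷ []) ⟩
  runCount 1 s + (countCodes (1 + s + 1) (pad (suc s) (soft ∷ [])) + 0)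
    ≡⟨ cong₂ _+_ (runCount-one s) (trans (ℕ.+-identityʳ _) last-gap) ⟩
  (2 + s) + 1
    ≡⟨ ℕ.+-comm (2 + s) 1 ⟩
  3 + s ∎
  where
  open ≡-Reasoning
  last-gap : countCodes (1 + s + 1) (pad (suc s) (soft ∷ [])) ≡ 1
  last-gap = trans (padded-suc (1 + s + 1) s [])
    (trans (cong (λ n → padded (suc n) (suc s) []) (ℕ.+-suc s 0)) (runCount-zero (suc s)))

-- The expansion of the continuant at its end of smallest weight, 1 + s.
runCount-rec : ∀ a s →
  runCount (2 + a) s ≡ runCount (1 + a) (1 + s) + (1 + s) * runCount a (2 + s)
runCount-rec a s = begin
  runCount (2 + a) s
    ≡⟨ padded-hard-hard N s (replicate a hard) ⟩
  padded N s (soft ∷ replicate (1 + a) hard)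
    + (1 + s) * padded N s (soft ∷ soft ∷ replicate a hard)
    ≡⟨ cong₂ (λ p q → p + (1 + s) * q) (padded-suc N s _)
         (trans (padded-suc N s _) (padded-suc N (1 + s) _)) ⟩
  padded N (1 + s) (replicate (1 + a) hard) + (1 + s) * padded N (2 + s) (replicate a hard)
    ≡⟨ cong₂ (λ p q → padded p (1 + s) (replicate (1 + a) hard)
                      + (1 + s) * padded q (2 + s) (replicate a hard))
         (cong suc (ℕ.+-suc s (1 + a)))
         (cong suc (trans (ℕ.+-suc s (1 + a)) (cong suc (ℕ.+-suc s a)))) ⟩
  runCount (1 + a) (1 + s) + (1 + s) * runCount a (2 + s) ∎
  where
  open ≡-Reasoning
  N : ℕ
  N = suc (s + (2 + a))

-- The expansion of the same continuant at its end of largest weight.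
runCount-rec′ : ∀ a s → runCount (2 + a) s ≡ runCount (1 + a) s + (2 + (s + a)) * runCount a s
runCount-rec′ zero s = begin
  runCount 2 s ≡⟨ runCount-rec 0 s ⟩
  runCount 1 (1 + s) + (1 + s) * runCount 0 (2 + s)
    ≡⟨ cong₂ (λ p q → p + (1 + s) * q) (runCount-one (1 + s)) (runCount-zero (2 + s)) ⟩
  (3 + s) + (1 + s) * 1 ≡⟨ arith s ⟩
  (2 + s) + (2 + (s + 0)) * 1
    ≡⟨ cong₂ (λ p q → p + (2 + (s + 0)) * q) (runCount-one s) (runCount-zero s) ⟨
  runCount 1 s + (2 + (s + 0)) * runCount 0 s ∎
  where
  open ≡-Reasoning
  arith : ∀ s → (3 + s) + (1 + s) * 1 ≡ (2 + s) + (2 + (s + 0)) * 1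
  arith = solve-∀
runCount-rec′ (suc zero) s = begin
  runCount 3 s ≡⟨ runCount-rec 1 s ⟩
  runCount 2 (1 + s) + (1 + s) * runCount 1 (2 + s)
    ≡⟨ cong₂ (λ p q → p + (1 + s) * q) (runCount-rec′ 0 (1 + s)) (runCount-one (2 + s)) ⟩
  (runCount 1 (1 + s) + (2 + (1 + s + 0)) * runCount 0 (1 + s)) + (1 + s) * (4 + s)
    ≡⟨ cong₂ (λ p q → (p + (2 + (1 + s + 0)) * q) + (1 + s) * (4 + s))
         (runCount-one (1 + s)) (runCount-zero (1 + s)) ⟩
  ((3 + s) + (2 + (1 + s + 0)) * 1) + (1 + s) * (4 + s)
    ≡⟨ arith s ⟩
  ((2 + s) + (2 + (s + 0)) * 1) + (2 + (s + 1)) * (2 + s)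
    ≡⟨ cong₂ (λ p q → (p + (2 + (s + 0)) * q) + (2 + (s + 1)) * p)
         (runCount-one s) (runCount-zero s) ⟨
  (runCount 1 s + (2 + (s + 0)) * runCount 0 s) + (2 + (s + 1)) * runCount 1 s
    ≡⟨ cong (_+ (2 + (s + 1)) * runCount 1 s) (runCount-rec′ 0 s) ⟨
  runCount 2 s + (2 + (s + 1)) * runCount 1 s ∎
  where
  open ≡-Reasoning
  arith : ∀ s → ((3 + s) + (2 + (1 + s + 0)) * 1) + (1 + s) * (4 + s)
    ≡ ((2 + s) + (2 + (s + 0)) * 1) + (2 + (s + 1)) * (2 + s)
  arith = solve-∀
runCount-rec′ (suc (suc a)) s = begin
  runCount (4 + a) s ≡⟨ runCount-rec (2 + a) s ⟩
  runCount (3 + a) (1 + s) + (1 + s) * runCount (2 + a) (2 + s)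
    ≡⟨ cong₂ (λ p q → p + (1 + s) * q) (runCount-rec′ (suc a) (1 + s)) (runCount-rec′ a (2 + s)) ⟩
  (runCount (2 + a) (1 + s) + (2 + (1 + s + (1 + a))) * runCount (1 + a) (1 + s))
    + (1 + s) * (runCount (1 + a) (2 + s) + (2 + (2 + s + a)) * runCount a (2 + s))
    ≡⟨ collect s a (runCount (2 + a) (1 + s)) (runCount (1 + a) (1 + s))
         (runCount (1 + a) (2 + s)) (runCount a (2 + s)) ⟩
  (runCount (2 + a) (1 + s) + (1 + s) * runCount (1 + a) (2 + s))
    + (2 + (s + (2 + a))) * (runCount (1 + a) (1 + s) + (1 + s) * runCount a (2 + s))
    ≡⟨ cong₂ (λ p q → p + (2 + (s + (2 + a))) * q) (runCount-rec (1 + a) s) (runCount-rec a s) ⟨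
  runCount (3 + a) s + (2 + (s + (2 + a))) * runCount (2 + a) s ∎
  where
  open ≡-Reasoning
  collect : ∀ s a x y z w →
    (x + (2 + (1 + s + (1 + a))) * y) + (1 + s) * (z + (2 + (2 + s + a)) * w)
    ≡ (x + (1 + s) * z) + (2 + (s + (2 + a))) * (y + (1 + s) * w)
  collect = solve-∀

-- Permutations as lists

Unique-resp : {xs ys : List ℕ} → xs ↭ ys → Unique xs → Unique ys
Unique-resp p = ↭ₛ.Unique-resp-↭ (setoid ℕ) (↭⇒↭ₛ p)

∈⇒↭ : ∀ {x : ℕ} {xs} → x ∈ xs → ∃ λ ys → xs ↭ x ∷ ys
∈⇒↭ i with ys , zs , refl ← ∈-∃++ i = ys ++ zs , shift _ ys zs

private
  narrow : ∀ {k n x} → x ≢ k → k ≤ x × x < k + suc n → suc k ≤ x × x < suc k + n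
  narrow {k} {n} {x} x≢k (k≤x , x<) =
    ℕ.≤∧≢⇒< k≤x (x≢k ∘ sym) , subst (x <_) (ℕ.+-suc k n) x<

  All-≢ : ∀ {k : ℕ} {xs} → k ∉ xs → All (_≢ k) xs
  All-≢ {xs = []}    k∉ = []
  All-≢ {xs = _ ∷ _} k∉ = (λ e → k∉ (here (sym e))) ∷ All-≢ (k∉ ∘ there)

-- Pigeonhole principle: distinct letters of an interval of length n are at
-- most n in number.
unique-length : ∀ n k {xs} → Unique xs → All (λ x → k ≤ x × x < k + n) xs → length xs ≤ n
unique-length zero k {[]}    _ _               = z≤n
unique-length zero k {x ∷ _} _ ((k≤x , x<) ∷ _) =
  contradiction (subst (x <_) (ℕ.+-identityʳ k) x<) (ℕ.≤⇒≯ k≤x)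
unique-length (suc n) k {xs} un a with k ∈? xs
... | no k∉ = ℕ.m≤n⇒m≤1+n
      (unique-length n (suc k) un (All.zipWith (λ (p , q) → narrow p q) (All-≢ k∉ , a)))
... | yes k∈
  with ys , p ← ∈⇒↭ k∈
  with k≢ ∷ un′ ← Unique-resp p un | _ ∷ a′ ← All-resp-↭ p a =
  subst (_≤ suc n) (sym (↭-length p))
    (s≤s (unique-length n (suc k) un′ (All.zipWith (λ (p , q) → narrow (p ∘ sym) q) (k≢ , a′))))

unique⇒↭interval : ∀ n k {xs} → length xs ≡ n → Unique xs →
  All (λ x → k ≤ x × x < k + n) xs → xs ↭ interval k n
unique⇒↭interval zero    k {[]} _ _ _ = ↭-refl
unique⇒↭interval (suc n) k {xs} e un a with k ∈? xs
... | no k∉ = contradiction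
      (unique-length n (suc k) un (All.zipWith (λ (p , q) → narrow p q) (All-≢ k∉ , a)))
      (ℕ.<⇒≱ (ℕ.≤-reflexive (sym e)))
... | yes k∈
  with ys , p ← ∈⇒↭ k∈
  with k≢ ∷ un′ ← Unique-resp p un | _ ∷ a′ ← All-resp-↭ p a =
  ↭-trans p (prep k (unique⇒↭interval n (suc k)
    (ℕ.suc-injective (trans (sym (↭-length p)) e)) un′
    (All.zipWith (λ (p , q) → narrow (p ∘ sym) q) (k≢ , a′))))

interval-unique : ∀ k n → Unique (interval k n)
interval-unique k zero    = []
interval-unique k (suc n) =
  All.map (λ (p , _) → ℕ.<⇒≢ p) (All-interval (suc k) n) ∷ interval-unique (suc k) n

toList-unique : ∀ {n} {xs : Vec ℕ n} → VUnique.Unique xs → Unique (toList xs)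
toList-unique []       = []
toList-unique (p ∷ ps) = VAll.toList⁺ p ∷ toList-unique ps

unique-toList : ∀ {n} {xs : Vec ℕ n} → Unique (toList xs) → VUnique.Unique xs
unique-toList {xs = []}    []       = []
unique-toList {xs = _ ∷ _} (p ∷ ps) = VAll.toList⁻ p ∷ unique-toList ps

-- The word of a permutation, read backwards to match the order in which
-- schemes are listed.
word : ∀ {n} → Perm n → List ℕ
word π = reverse (toList (value π))

toList-↭ : ∀ {n} (π : Perm n) → toList (value π) ↭ interval 1 n
toList-↭ {n} π with a , u ← isPerm π =
  unique⇒↭interval n 1 (Vec.length-toList (value π)) (toList-unique u)
    (All.map (λ (p , q) → p , s≤s q) (VAll.toList⁺ a))

word-↭ : ∀ {n} (π : Perm n) → word π ↭ interval 1 n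
word-↭ π = ↭-trans (↭-reverse _) (toList-↭ π)

word-injective : ∀ {n} {π ρ : Perm n} → word π ≡ word ρ → π ≡ ρ
word-injective {π = π} {ρ} e
  with refl ← trans (sym (Vec.cast-is-id refl (value π)))
                (Vec.toList-injective refl (value π) (value ρ) (List.reverse-injective e)) = refl

word-surjective : ∀ {n w} → w ↭ interval 1 n → ∃ λ (π : Perm n) → word π ≡ w
word-surjective {n} {w} p = (letters ,ᵣ [ VAll.toList⁻ in-range , unique-toList un ]) , e′
  where
  len : length (reverse w) ≡ n
  len = trans (List.length-reverse w) (trans (↭-length p) (interval-length 1 n))
  letters : Vec ℕ n
  letters = Vec.cast len (Vec.fromList (reverse w))
  e : toList letters ≡ reverse w
  e = trans (Vec.toList-cast len _) (Vec.toList∘fromList _)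
  e′ : reverse (toList letters) ≡ w
  e′ = trans (cong reverse e) (List.reverse-involutive w)
  q : interval 1 n ↭ toList letters
  q = subst (interval 1 n ↭_) (sym e) (↭-trans (↭-sym p) (↭-sym (↭-reverse w)))
  in-range : All (λ x → 1 ≤ x × x ≤ n) (toList letters)
  in-range = All-resp-↭ q (All.map (λ { (p , s≤s q) → p , q }) (All-interval 1 n))
  un : Unique (toList letters)
  un = Unique-resp q (interval-unique 1 n)

-- Replacements of three letters

-- The replacements of three letters described by K₀: the smallest letter
-- stays in its place, the first or the middle one, and the other two are
-- exchanged.
data Exchange : Vec ℕ 3 → Vec ℕ 3 → Set where
  min-first  : ∀ {a b c} → a < b → a < c → Exchange (a ∷ b ∷ c ∷ []) (a ∷ c ∷ b ∷ [])
  min-middle : ∀ {a b c} → b < a → b < c → Exchange (a ∷ b ∷ c ∷ []) (c ∷ b ∷ a ∷ [])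

-- The six orders in which three letters can be written.
data Arrangement (a b c : ℕ) : Vec ℕ 3 → Set where
  abc : Arrangement a b c (a ∷ b ∷ c ∷ [])
  acb : Arrangement a b c (a ∷ c ∷ b ∷ [])
  bac : Arrangement a b c (b ∷ a ∷ c ∷ [])
  bca : Arrangement a b c (b ∷ c ∷ a ∷ [])
  cab : Arrangement a b c (c ∷ a ∷ b ∷ [])
  cba : Arrangement a b c (c ∷ b ∷ a ∷ [])

private
  singleton : ∀ {x a : ℕ} → x ∷ [] ↭ a ∷ [] → x ≡ a
  singleton p with here e ← ∈-resp-↭ p (here refl) = e

  pair : ∀ {x y a b : ℕ} → x ∷ y ∷ [] ↭ a ∷ b ∷ [] → (x ≡ a × y ≡ b) ⊎ (x ≡ b × y ≡ a)
  pair p with ∈-resp-↭ p (here refl)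
  ... | here refl = inj₁ (refl , singleton (drop-∷ p))
  ... | there (here refl) =
        inj₂ (refl , singleton (drop-∷ (↭-trans p (↭-swap _ _ ↭-refl))))

arrangement : ∀ {a b c} (v : Vec ℕ 3) → toList v ↭ a ∷ b ∷ c ∷ [] → Arrangement a b c v
arrangement (x ∷ y ∷ z ∷ []) p with ∈-resp-↭ p (here refl)
... | here refl with pair (drop-∷ p)
...   | inj₁ (refl , refl) = abc
...   | inj₂ (refl , refl) = acb
arrangement (x ∷ y ∷ z ∷ []) p | there (here refl)
  with pair (drop-∷ (↭-trans p (↭-swap _ _ ↭-refl)))
...   | inj₁ (refl , refl) = bac
...   | inj₂ (refl , refl) = bca
arrangement (x ∷ y ∷ z ∷ []) p | there (there (here refl))
  with pair (drop-∷ (↭-trans p (shift _ (_ ∷ _ ∷ []) [])))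
...   | inj₁ (refl , refl) = cab
...   | inj₂ (refl , refl) = cba

monotone⇒order : ∀ {c} (σ : Perm c) (u : Vec ℕ c) →
  (∀ i j → lookup (value σ) i < lookup (value σ) j → lookup u i < lookup u j) →
  σ IsOrderPermOf u
monotone⇒order σ u mono i j = mk⇔ (mono i j) back
  where
  back : lookup u i < lookup u j → lookup (value σ) i < lookup (value σ) j
  back p with ℕ.<-cmp (lookup (value σ) i) (lookup (value σ) j)
  ... | tri< q _ _ = q
  ... | tri> _ _ q = contradiction (mono j i q) (ℕ.<-asym p)
  ... | tri≈ _ e _ = contradiction p
        (ℕ.<-irrefl (cong (lookup u) (lookup-injective (proj₂ (isPerm σ)) i j e)))

p123 p132 p213 p312 : Perm 3
p123 = perm (1 ∷ 2 ∷ 3 ∷ [])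
p132 = perm (1 ∷ 3 ∷ 2 ∷ [])
p213 = perm (2 ∷ 1 ∷ 3 ∷ [])
p312 = perm (3 ∷ 1 ∷ 2 ∷ [])

order-123 : ∀ {x y z} → x < y → y < z → p123 IsOrderPermOf (x ∷ y ∷ z ∷ [])
order-123 x<y y<z = monotone⇒order p123 (_ ∷ _ ∷ _ ∷ []) λ where
  0F 1F _ → x<y
  0F 2F _ → ℕ.<-trans x<y y<z
  1F 2F _ → y<z
  0F 0F (s≤s ())
  1F 0F (s≤s ())
  1F 1F (s≤s (s≤s ()))
  2F 0F (s≤s ())
  2F 1F (s≤s (s≤s ()))
  2F 2F (s≤s (s≤s (s≤s ())))

order-132 : ∀ {x y z} → x < z → z < y → p132 IsOrderPermOf (x ∷ y ∷ z ∷ [])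
order-132 x<z z<y = monotone⇒order p132 (_ ∷ _ ∷ _ ∷ []) λ where
  0F 1F _ → ℕ.<-trans x<z z<y
  0F 2F _ → x<z
  2F 1F _ → z<y
  0F 0F (s≤s ())
  1F 0F (s≤s ())
  1F 1F (s≤s (s≤s (s≤s ())))
  1F 2F (s≤s (s≤s ()))
  2F 0F (s≤s ())
  2F 2F (s≤s (s≤s ()))

order-213 : ∀ {x y z} → y < x → x < z → p213 IsOrderPermOf (x ∷ y ∷ z ∷ [])
order-213 y<x x<z = monotone⇒order p213 (_ ∷ _ ∷ _ ∷ []) λ where
  1F 0F _ → y<x
  0F 2F _ → x<z
  1F 2F _ → ℕ.<-trans y<x x<z
  0F 0F (s≤s (s≤s ()))
  0F 1F (s≤s ())
  1F 1F (s≤s ())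
  2F 0F (s≤s (s≤s ()))
  2F 1F (s≤s ())
  2F 2F (s≤s (s≤s (s≤s ())))

order-312 : ∀ {x y z} → y < z → z < x → p312 IsOrderPermOf (x ∷ y ∷ z ∷ [])
order-312 y<z z<x = monotone⇒order p312 (_ ∷ _ ∷ _ ∷ []) λ where
  1F 2F _ → y<z
  2F 0F _ → z<x
  1F 0F _ → ℕ.<-trans y<z z<x
  0F 0F (s≤s (s≤s (s≤s ())))
  0F 1F (s≤s ())
  0F 2F (s≤s (s≤s ()))
  1F 1F (s≤s ())
  2F 1F (s≤s ())
  2F 2F (s≤s (s≤s ()))

exchange⇒replaceable : ∀ {u v} → Unique (toList u) → Exchange u v → Replaceable K₀ u v
exchange⇒replaceable {u = _ ∷ b ∷ c ∷ []} (_ ∷ (b≢c ∷ _) ∷ _) (min-first a<b a<c) with ℕ.<-cmp b c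
... | tri< b<c _ _ = p123 , p132 , order-123 a<b b<c , order-132 a<b b<c ,
                     inj₂ (here (here refl , there (here refl)))
... | tri> _ _ c<b = p132 , p123 , order-132 a<c c<b , order-123 a<c c<b ,
                     inj₂ (here (there (here refl) , here refl))
... | tri≈ _ b≡c _ = contradiction b≡c b≢c
exchange⇒replaceable {u = a ∷ _ ∷ c ∷ []} ((_ ∷ a≢c ∷ _) ∷ _) (min-middle b<a b<c) with ℕ.<-cmp a c
... | tri< a<c _ _ = p213 , p312 , order-213 b<a a<c , order-312 b<a a<c ,
                     inj₂ (there (here (here refl , there (here refl))))
... | tri> _ _ c<a = p312 , p213 , order-312 b<c c<a , order-213 b<c c<a ,
                     inj₂ (there (here (there (here refl) , here refl)))
... | tri≈ _ a≡c _ = contradiction a≡c a≢c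

-- The smallest of three letters comes first, or in the middle.
MinFirst MinMiddle : Vec ℕ 3 → Set
MinFirst  (a ∷ b ∷ c ∷ []) = a < b × a < c
MinMiddle (a ∷ b ∷ c ∷ []) = b < a × b < c

minFirst : ∀ {σ} u → σ ∈ p123 ∷ p132 ∷ [] → σ IsOrderPermOf u → MinFirst u
minFirst (_ ∷ _ ∷ _ ∷ []) (here refl) o =
  Equivalence.to (o 0F 1F) (s≤s (s≤s z≤n)) , Equivalence.to (o 0F 2F) (s≤s (s≤s z≤n))
minFirst (_ ∷ _ ∷ _ ∷ []) (there (here refl)) o =
  Equivalence.to (o 0F 1F) (s≤s (s≤s z≤n)) , Equivalence.to (o 0F 2F) (s≤s (s≤s z≤n))

minMiddle : ∀ {σ} u → σ ∈ p213 ∷ p312 ∷ [] → σ IsOrderPermOf u → MinMiddle u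
minMiddle (_ ∷ _ ∷ _ ∷ []) (here refl) o =
  Equivalence.to (o 1F 0F) (s≤s (s≤s z≤n)) , Equivalence.to (o 1F 2F) (s≤s (s≤s z≤n))
minMiddle (_ ∷ _ ∷ _ ∷ []) (there (here refl)) o =
  Equivalence.to (o 1F 0F) (s≤s (s≤s z≤n)) , Equivalence.to (o 1F 2F) (s≤s (s≤s z≤n))

minFirst-arranged : ∀ {a b c v} → MinFirst (a ∷ b ∷ c ∷ []) → MinFirst v →
  Arrangement a b c v → a ∷ b ∷ c ∷ [] ≡ v ⊎ Exchange (a ∷ b ∷ c ∷ []) v
minFirst-arranged _         _         abc = inj₁ refl
minFirst-arranged (p , q)   _         acb = inj₂ (min-first p q)
minFirst-arranged (a<b , _) (b<a , _) bac = asym a<b b<a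
minFirst-arranged (a<b , _) (_ , b<a) bca = asym a<b b<a
minFirst-arranged (_ , a<c) (c<a , _) cab = asym a<c c<a
minFirst-arranged (_ , a<c) (_ , c<a) cba = asym a<c c<a

minMiddle-arranged : ∀ {a b c v} → MinMiddle (a ∷ b ∷ c ∷ []) → MinMiddle v →
  Arrangement a b c v → a ∷ b ∷ c ∷ [] ≡ v ⊎ Exchange (a ∷ b ∷ c ∷ []) v
minMiddle-arranged _         _         abc = inj₁ refl
minMiddle-arranged (p , q)   _         cba = inj₂ (min-middle p q)
minMiddle-arranged (_ , b<c) (_ , c<b) acb = asym b<c c<b
minMiddle-arranged (b<a , _) (a<b , _) bac = asym b<a a<b
minMiddle-arranged (_ , b<c) (c<b , _) bca = asym b<c c<b
minMiddle-arranged (b<a , _) (_ , a<b) cab = asym b<a a<b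

private
  compare : ∀ {A : Set} {x y} → x ≢ y → (x < y → A) → (y < x → A) → A
  compare {x = x} {y} x≢y f g with ℕ.<-cmp x y
  ... | tri< p _ _ = f p
  ... | tri≈ _ e _ = contradiction e x≢y
  ... | tri> _ _ p = g p

  no-cycle : ∀ {A : Set} {x y z} → x < y → y < z → z < x → A
  no-cycle p q r = contradiction r (ℕ.<-asym (ℕ.<-trans p q))

same-order-arranged : ∀ {a b c v} → Unique (a ∷ b ∷ c ∷ []) →
  (∀ i j → lookup (a ∷ b ∷ c ∷ []) i < lookup (a ∷ b ∷ c ∷ []) j → lookup v i < lookup v j) →
  Arrangement a b c v → a ∷ b ∷ c ∷ [] ≡ v
same-order-arranged _ _ abc = refl
same-order-arranged (_ ∷ (b≢c ∷ _) ∷ _) o acb =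
  compare b≢c (λ p → asym p (o 1F 2F p)) (λ p → asym p (o 2F 1F p))
same-order-arranged ((a≢b ∷ _) ∷ _) o bac =
  compare a≢b (λ p → asym p (o 0F 1F p)) (λ p → asym p (o 1F 0F p))
same-order-arranged ((_ ∷ a≢c ∷ _) ∷ _) o cba =
  compare a≢c (λ p → asym p (o 0F 2F p)) (λ p → asym p (o 2F 0F p))
same-order-arranged ((a≢b ∷ _) ∷ _) o bca = compare a≢b
  (λ p → let q = o 0F 1F p in no-cycle p q (o 1F 2F q))
  (λ p → let q = o 1F 0F p in no-cycle q p (o 2F 1F q))
same-order-arranged ((a≢b ∷ _) ∷ _) o cab = compare a≢b
  (λ p → let q = o 0F 1F p in no-cycle q p (o 2F 0F q))
  (λ p → let q = o 1F 0F p in no-cycle p q (o 0F 2F q))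

-- Replaceability compares order permutations only, whence the hypothesis that
-- u and v have the same letters.
replaceable⇒exchange : ∀ {u v} → Unique (toList u) → toList v ↭ toList u →
  Replaceable K₀ u v → u ≡ v ⊎ Exchange u v
replaceable⇒exchange {_ ∷ _ ∷ _ ∷ []} {v} un p (σ , τ , σu , τv , inj₁ refl) =
  inj₁ (same-order-arranged un
    (λ i j → Equivalence.to (τv i j) ∘ Equivalence.from (σu i j)) (arrangement v p))
replaceable⇒exchange {_ ∷ _ ∷ _ ∷ []} {v} _ p (σ , τ , σu , τv , inj₂ (here (i , j))) =
  minFirst-arranged (minFirst _ i σu) (minFirst v j τv) (arrangement v p)
replaceable⇒exchange {_ ∷ _ ∷ _ ∷ []} {v} _ p (σ , τ , σu , τv , inj₂ (there (here (i , j)))) =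
  minMiddle-arranged (minMiddle _ i σu) (minMiddle v j τv) (arrangement v p)

-- Equivalence classes and codes

-- The scheme of a permutation: all gaps between letters are hard, and the one
-- in front of the first letter is soft by convention.
hardScheme : ℕ → Scheme
hardScheme zero    = []
hardScheme (suc n) = soft ∷ replicate n hard

exchange⇒move : ∀ {g} p {n u v q} → Exchange u v →
  suc n ≡ length (p ++ reverse (toList u) ++ q) →
  Move (g ∷ replicate n hard) (p ++ reverse (toList u) ++ q) (p ++ reverse (toList v) ++ q)
exchange⇒move []      {suc (suc n)} (min-first a<b a<c)  _ = before a<c a<b
exchange⇒move []      {suc (suc n)} (min-middle b<a b<c) _ = around b<c b<a
exchange⇒move (x ∷ p) {suc n} e l = skip (exchange⇒move p e (ℕ.suc-injective l))
exchange⇒move (x ∷ p) {zero} {u = _ ∷ _ ∷ _ ∷ []} e l with p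
... | [] = contradiction (ℕ.suc-injective l) λ ()
... | _ ∷ _ = contradiction (ℕ.suc-injective l) λ ()

move⇒exchange : ∀ {g n w w′} → Move (g ∷ replicate n hard) w w′ →
  ∃₂ λ p q → ∃₂ λ u v → Exchange u v ×
    w ≡ p ++ reverse (toList u) ++ q × w′ ≡ p ++ reverse (toList v) ++ q
move⇒exchange {n = suc (suc n)} (before {x = x} {y} {u = q} a<x a<y) =
  [] , q , _ , _ , min-first a<y a<x , refl , refl
move⇒exchange {n = suc (suc n)} (around b<x b<y) =
  [] , _ , _ , _ , min-middle b<y b<x , refl , refl
move⇒exchange {n = zero} (skip ())
move⇒exchange {n = suc n} (skip s)
  with p , q , u , v , e , refl , refl ← move⇒exchange s =
  _ ∷ p , q , u , v , e , refl , refl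

reverse-factors : ∀ (a u b : List ℕ) → reverse (a ++ u ++ b) ≡ reverse b ++ reverse u ++ reverse a
reverse-factors a u b = trans (List.reverse-++ a (u ++ b))
  (trans (cong (_++ reverse a) (List.reverse-++ u b)) (List.++-assoc (reverse b) _ _))

↭-dropˡ : ∀ (a : List ℕ) {u v} → a ++ u ↭ a ++ v → u ↭ v
↭-dropˡ []      p = p
↭-dropˡ (_ ∷ a) p = ↭-dropˡ a (drop-∷ p)

↭-dropʳ : ∀ {u v} (b : List ℕ) → u ++ b ↭ v ++ b → u ↭ v
↭-dropʳ {u} {v} b p = ↭-dropˡ b (↭-trans (++-comm b u) (↭-trans p (++-comm v b)))

unique-factor : ∀ a (u : Vec ℕ 3) {b} → Unique (a ++ toList u ++ b) → Unique (toList u)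
unique-factor a u@(_ ∷ _ ∷ _ ∷ []) un with Unique-resp (shifts a (toList u)) un
... | (p ∷ q ∷ _) ∷ (r ∷ _) ∷ _ ∷ _ = (p ∷ q ∷ []) ∷ (r ∷ []) ∷ [] ∷ []

toList-unique-perm : ∀ {n} (π : Perm n) → Unique (toList (value π))
toList-unique-perm π = toList-unique (proj₂ (isPerm π))

replace⇒move : ∀ {n} (π ρ : Perm n) → Replace K₀ n π ρ →
  word π ≡ word ρ ⊎ Move (hardScheme n) (word π) (word ρ)
replace⇒move {n} π ρ (a , b , u , v , eπ , eρ , r)
  with replaceable⇒exchange (unique-factor a u (subst Unique eπ (toList-unique-perm π)))
         (↭-dropʳ b (↭-dropˡ a (subst₂ _↭_ eρ eπ (↭-trans (toList-↭ ρ) (↭-sym (toList-↭ π))))))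
         r
... | inj₁ refl = inj₁ (cong reverse (trans eπ (sym eρ)))
... | inj₂ e = inj₂ (subst₂ (Move (hardScheme n)) (sym wπ) (sym wρ) (step n len))
  where
  wπ : word π ≡ reverse b ++ reverse (toList u) ++ reverse a
  wπ = trans (cong reverse eπ) (reverse-factors a (toList u) b)
  wρ : word ρ ≡ reverse b ++ reverse (toList v) ++ reverse a
  wρ = trans (cong reverse eρ) (reverse-factors a (toList v) b)
  len : n ≡ length (reverse b ++ reverse (toList u) ++ reverse a)
  len = trans (sym (trans (↭-length (word-↭ π)) (interval-length 1 n))) (cong length wπ)
  step : ∀ n → n ≡ length (reverse b ++ reverse (toList u) ++ reverse a) →
    Move (hardScheme n) (reverse b ++ reverse (toList u) ++ reverse a)
                        (reverse b ++ reverse (toList v) ++ reverse a)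
  step (suc n) l = exchange⇒move (reverse b) e l
  step zero l =
    contradiction (trans l (↭-length (shifts (reverse b) (reverse (toList u))))) (nonempty u)
    where
    nonempty : ∀ (u : Vec ℕ 3) {x} → 0 ≢ length (reverse (toList u) ++ x)
    nonempty (_ ∷ _ ∷ _ ∷ []) ()

move⇒replace : ∀ {n} (π ρ : Perm n) →
  Move (hardScheme n) (word π) (word ρ) → Replace K₀ n π ρ
move⇒replace {suc n} π ρ s with p , q , u , v , e , wπ , wρ ← move⇒exchange s =
  reverse q , reverse p , u , v , eπ , unword ρ p q v wρ ,
  exchange⇒replaceable (unique-factor (reverse q) u (subst Unique eπ (toList-unique-perm π))) e
  where
  unword : ∀ (π : Perm (suc n)) p q (u : Vec ℕ 3) → word π ≡ p ++ reverse (toList u) ++ q →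
    toList (value π) ≡ reverse q ++ toList u ++ reverse p
  unword π p q u e = trans (sym (List.reverse-involutive _))
    (trans (cong reverse e) (trans (reverse-factors p _ q)
      (cong (λ x → reverse q ++ x ++ reverse p) (List.reverse-involutive (toList u)))))
  eπ : toList (value π) ≡ reverse q ++ toList u ++ reverse p
  eπ = unword π p q u wπ

hardScheme-length : ∀ n → length (hardScheme n) ≡ n
hardScheme-length zero    = refl
hardScheme-length (suc n) = cong suc (List.length-replicate n)

module _ {n : ℕ} where
  open Setoid (K-equivalence K₀ n) using (_≈_) renaming (refl to ≈-refl)

  -- The code of the backward word of a permutation, found by deleting the
  -- letters 1, ..., n in turn.
  code : Perm n → Code n (hardScheme n)
  code π = proj₁ (hasCode-total n (hardScheme n) (hardScheme-length n) (word-↭ π))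

  code-correct : ∀ π → HasCode 1 (code π) (word π)
  code-correct π = proj₂ (hasCode-total n (hardScheme n) (hardScheme-length n) (word-↭ π))

  code-replace : ∀ {π ρ} → Replace K₀ n π ρ → code π ≡ code ρ
  code-replace {π} {ρ} r with replace⇒move π ρ r
  ... | inj₁ e = hasCode-unique (subst (HasCode 1 (code π)) e (code-correct π)) (code-correct ρ)
  ... | inj₂ s = hasCode-unique (hasCode-move (code-correct π) s) (code-correct ρ)

  code-cong : ∀ {π ρ} → π ≈ ρ → code π ≡ code ρ
  code-cong = Closure.gfold ≡.isEquivalence code (λ {π} {ρ} → code-replace {π} {ρ})

  moves⇒≈ : ∀ {w w′} → hardScheme n ⊢ w ⟶* w′ → ∀ π ρ → word π ≡ w → word ρ ≡ w′ → π ≈ ρ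
  moves⇒≈ ε π ρ refl e with refl ← word-injective {π = ρ} {π} e = ≈-refl
  moves⇒≈ (s ◅ t) π ρ refl e
    with σ , refl ← word-surjective (↭-trans (↭-sym (Move⇒↭ s)) (word-↭ π)) =
    fwd (move⇒replace π σ s) ◅ moves⇒≈ t σ ρ refl e

  code-injective : ∀ {π ρ} → code π ≡ code ρ → π ≈ ρ
  code-injective {π} {ρ} e =
    moves⇒≈
      (hasCode⇒moves (code-correct π)
        (subst (λ c → HasCode 1 c (word ρ)) (sym e) (code-correct ρ)))
      π ρ refl refl

  code-surjective : ∀ c → ∃ λ π → code π ≡ c
  code-surjective c
    with w , q ← hasCode-exists c 1
    with π , refl ← word-surjective (hasCode-↭ q) = π , hasCode-unique (code-correct π) q

  classes-codes : HasClasses (K-equivalence K₀ n) (countCodes n (hardScheme n))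
  classes-codes = record
    { to        = Inverse.to codes ∘ code
    ; cong      = cong (Inverse.to codes) ∘ code-cong
    ; bijective = code-injective ∘ injective
                , λ i → let π , e = code-surjective (Inverse.from codes i) in
                    π , λ {ρ} r → trans (cong (Inverse.to codes) (trans (code-cong r) e))
                                    (Inverse.strictlyInverseˡ codes i)
    }
    where
    codes = codes↔ n (hardScheme n)
    injective : ∀ {c d} → Inverse.to codes c ≡ Inverse.to codes d → c ≡ d
    injective e = trans (sym (Inverse.strictlyInverseʳ codes _))
      (trans (cong (Inverse.from codes) e) (Inverse.strictlyInverseʳ codes _))

numClasses-runCount : ∀ n → numClasses K₀ (suc n) ≡ runCount n 0
numClasses-runCount n = hasClasses-unique (K-equivalence K₀ (suc n))
  (proj₂ (classes K₀ (suc n))) classes-codes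

proposition3p44 : let f = numClasses K₀ in
    ∀ (n : ℕ) → 3 ≤ n → f n ≡ f (n ∸ 1) + (n ∸ 1) * f (n ∸ 2)
proposition3p44 (suc zero)          (s≤s ())
proposition3p44 (suc (suc zero))    (s≤s (s≤s ()))
proposition3p44 (suc (suc (suc n))) _ = begin
  numClasses K₀ (3 + n) ≡⟨ numClasses-runCount (2 + n) ⟩
  runCount (2 + n) 0    ≡⟨ runCount-rec′ n 0 ⟩
  runCount (1 + n) 0 + (2 + n) * runCount n 0
    ≡⟨ cong₂ (λ p q → p + (2 + n) * q) (numClasses-runCount (1 + n)) (numClasses-runCount n) ⟨
  numClasses K₀ (2 + n) + (2 + n) * numClasses K₀ (1 + n) ∎
  where open ≡-Reasoning
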